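{- For integers $n>p\ge 1$, the number of $123$-avoiding ordered partitions of $[n]$ into $n-p+1$ blocks, of which exactly one block has size $p$ and the other $n-p$ blocks have size $1$, is $$\frac{(n-p+1)(p+1)\binom{2n-p}{n-p}}{n+1}.$$
   Context: An ordered set partition of $[n]$ into $k$ blocks is a sequence $B_1/B_2/\cdots/B_k$ of nonempty, pairwise disjoint subsets of $[n]$ whose union is $[n]$; the order of the blocks matters, but not the order of elements within a block. Such a partition contains the pattern $123$ if there are block indices $i_1<i_2<i_3$ and elements $b_j\in B_{i_j}$ with $b_1<b_2<b_3$; otherwise it avoids $123$.
   Formalization: For p=1 the printed formula overcounts (n=2 gives 4, but only 2 partitions exist), so what is proved is the count of partitions for p≥2, and for all p≥1 the count of partitions together with a chosen block of size p whose other blocks all have size 1. -}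

module Defs where

open import Data.Fin using (Fin; _<_)
open import Data.Fin.Subset using (Subset; _∈_; _∩_; ∣_∣; Nonempty; Empty)
open import Data.List using (List; length)
import Data.List.Membership.Propositional as List
open import Data.List.Relation.Unary.Unique.Propositional using (Unique)
open import Data.Nat using (ℕ)
open import Data.Product using (Σ; ∃; _×_; _,_)
open import Data.Vec using (Vec; lookup)
open import Function.Bundles using (_⇔_)
open import Relation.Binary.PropositionalEquality using (_≡_; _≢_)
open import Relation.Nullary using (¬_)

-- [n] is represented by Fin n with its usual order.
record IsOrderedPartition {n k : ℕ} (B : Vec (Subset n) k) : Set where
  field
    nonempty : ∀ i → Nonempty (lookup B i)
    disjoint : ∀ i j → i ≢ j → Empty (lookup B i ∩ lookup B j)
    covers   : ∀ x → ∃ λ i → x ∈ lookup B i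

record Contains123 {n k : ℕ} (B : Vec (Subset n) k) : Set where
  field
    i₁ i₂ i₃ : Fin k
    b₁ b₂ b₃ : Fin n
    i₁<i₂ : i₁ < i₂
    i₂<i₃ : i₂ < i₃
    b₁∈   : b₁ ∈ lookup B i₁
    b₂∈   : b₂ ∈ lookup B i₂
    b₃∈   : b₃ ∈ lookup B i₃
    b₁<b₂ : b₁ < b₂
    b₂<b₃ : b₂ < b₃

Avoids123 : {n k : ℕ} → Vec (Subset n) k → Set
Avoids123 B = ¬ Contains123 B

SizePAt : {n k : ℕ} → ℕ → Vec (Subset n) k → Fin k → Set
SizePAt p B i = ∣ lookup B i ∣ ≡ p × (∀ j → j ≢ i → ∣ lookup B j ∣ ≡ 1)

AvoidingPartition : {n k : ℕ} → ℕ → Vec (Subset n) k → Set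
AvoidingPartition p B = IsOrderedPartition B × Avoids123 B × ∃ (SizePAt p B)

-- For p ≥ 2 the index i is determined by B.  For p = 1 every block may play
-- the role of "the block of size p", and the closed formula (n times a Catalan
-- number) counts the partition once for each choice of that block.
MarkedAvoidingPartition : {n k : ℕ} → ℕ → Vec (Subset n) k × Fin k → Set
MarkedAvoidingPartition p (B , i) =
  IsOrderedPartition B × Avoids123 B × SizePAt p B i

-- Exactly N elements of A satisfy P.  A repetition-free enumeration is used
-- because proofs of P need not be unique, so Σ A P cannot be counted directly.
HasCardinality : {A : Set} → (A → Set) → ℕ → Set
HasCardinality {A} P N =
  Σ (List A) λ xs → Unique xs × (∀ x → (x List.∈ xs) ⇔ P x) × length xs ≡ N

{-# OPTIONS --safe #-}
module Submission where

-- Reading off the block index of each element turns a partition into a word in which one letter i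
-- occurs p times and every other letter once, with 123 read strictly. Build the word by inserting its
-- letters in increasing order: the copies of a new largest letter may go exactly to the d + 1 sites
-- inside or at the ends of the initial weakly decreasing run, of length d, so d alone governs the
-- growth. Inserting p equal letters is thus an operator transfer p on functions of d. It commutes with
-- transfer 1, hence the count does not depend on i: the big letter may be inserted first, which leaves
-- the ballot number transfer 1 ^ (n - p) applied to the constant 1, evaluated at d = p.

open import Defs
open import Data.Bool using (Bool; true; false; if_then_else_)
open import Data.Fin as Fin using (Fin; zero; suc; toℕ; fromℕ<)
open import Data.Fin.Properties using (toℕ<n; toℕ-fromℕ<; toℕ-injective)
open import Data.Fin.Subset using (Subset; ∣_∣) renaming (_∈_ to _∈ₛ_)
open import Data.Fin.Subset.Properties using (⊆-antisym; x∈p∩q⁺; x∈p∩q⁻)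
open import Data.List using (List; []; _∷_; _++_; map; length; replicate; concatMap; allFin; tabulate)
open import Data.List.Membership.Propositional using (_∈_; find; lose)
open import Data.List.Membership.Propositional.Properties using (∈-map⁺; ∈-map⁻; ∈-++⁺ˡ; ∈-++⁺ʳ; ∈-++⁻; ∈-concatMap⁺; ∈-concatMap⁻; ∈-allFin)
open import Data.List.Properties using (∷-injectiveʳ; map-++; map-∘; length-map; length-++; length-tabulate)
open import Data.List.Relation.Unary.All as All using (All; []; _∷_)
open import Data.List.Relation.Unary.AllPairs using ([]; _∷_)
open import Data.List.Relation.Unary.Any using (here; there)
open import Data.List.Relation.Unary.Unique.Propositional using (Unique)
import Data.List.Relation.Unary.Unique.Propositional.Properties as Unique
open import Data.Nat
open import Data.Nat.Combinatorics using (_C_; nC1≡n; nCk≡nC[n∸k]; nCk+nC[k+1]≡[n+1]C[k+1])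
open import Data.Nat.ListAction using (sum)
open import Data.Nat.ListAction.Properties using (sum-++)
open import Data.Nat.Properties
open import Data.Nat.Tactic.RingSolver using (solve-∀)
open import Data.Product using (∃; ∃₂; _×_; _,_; proj₁; proj₂)
open import Data.Sum using (inj₁; inj₂)
open import Data.Unit using (⊤)
open import Data.Vec as Vec using (Vec; lookup)
open import Data.Vec.Properties using (lookup∘tabulate; tabulate∘lookup; tabulate-cong; []=⇒lookup; lookup⇒[]=)
open import Function using (_∘_; const)
open import Function.Bundles using (mk⇔; Equivalence)
open import Relation.Binary.PropositionalEquality
open import Relation.Nullary using (¬_; does; yes; no; contradiction)
open import Relation.Nullary.Decidable using (dec-true; dec-false)

-- A copy of the new letter `k` completes a 123 exactly when two older letters x < y stand before it
-- in this order, and equal copies never clash with each other; so the old letters before each copy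
-- must form a weakly decreasing prefix. Peeling off the largest letter replaces the summand `f` by
-- `transfer (c k) f`. The number of words is therefore the composite of `transfer (c 0)`, ...,
-- `transfer (c (k - 1))`, the last acting first, applied to the constant 1 and evaluated at 0, the
-- run of the empty word. The operator of the big letter sits somewhere inside this composite;
-- commutation moves it outermost, where evaluation at 0 turns it into evaluation at p. The
-- commutation is algebraic and uses no bijection: `transfer₁ g d` is the partial sum of g 1, ..., g
-- (d + 1), so it is enough to compare the increments in d, and these are handled by induction on p.
-- The factor n - p + 1 counts the choices of i, all of which contribute the same ballot number.

-- Transfer operators

-- Closed form of transfer 1 (see transfer-one).
transfer₁ : (ℕ → ℕ) → ℕ → ℕ
transfer₁ f zero    = f 1
transfer₁ f (suc d) = transfer₁ f d + f (2 + d)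

-- The binomial coefficient `(p + d) C p`, in the Pascal recursion given by the first letter of a
-- shuffle.
shuffles : ℕ → ℕ → ℕ
shuffles zero    d       = 1
shuffles (suc p) zero    = 1
shuffles (suc p) (suc d) = shuffles p (suc d) + shuffles (suc p) d

ascentTransfer : ℕ → (ℕ → ℕ) → ℕ → ℕ
ascentTransfer p g zero    = g 0
ascentTransfer p g (suc d) = g 0 * shuffles p (suc d) + ascentTransfer p (g ∘ suc) d

-- transfer p f d sums f (length of the initial weakly decreasing run of v) over all shuffles v of p
-- copies of a new largest letter with a weakly decreasing word of length d; ascentTransfer p g d
-- sums g (number of old letters before the first copy) over the shuffles of suc p copies with d letters.
transfer : ℕ → (ℕ → ℕ) → ℕ → ℕ
transfer zero    f d       = f d
transfer (suc p) f zero    = transfer p (f ∘ suc) zero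
transfer (suc p) f (suc d) = transfer p (f ∘ suc) (suc d) + ascentTransfer p (f ∘ suc) d

shuffles-zeroʳ : ∀ p → shuffles p 0 ≡ 1
shuffles-zeroʳ zero    = refl
shuffles-zeroʳ (suc p) = refl

ascentTransfer-cong : ∀ p {f g} → f ≗ g → ascentTransfer p f ≗ ascentTransfer p g
ascentTransfer-cong p f≗g zero    = f≗g 0
ascentTransfer-cong p f≗g (suc d) = cong₂ _+_ (cong (_* shuffles p (suc d)) (f≗g 0)) (ascentTransfer-cong p (f≗g ∘ suc) d)

ascentTransfer-+ : ∀ p f g d → ascentTransfer p (λ x → f x + g x) d ≡ ascentTransfer p f d + ascentTransfer p g d
ascentTransfer-+ p f g zero    = refl
ascentTransfer-+ p f g (suc d) rewrite ascentTransfer-+ p (f ∘ suc) (g ∘ suc) d =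
  regroup (f 0) (g 0) (shuffles p (suc d)) (ascentTransfer p (f ∘ suc) d) (ascentTransfer p (g ∘ suc) d)
  where
  regroup : ∀ a b m v w → (a + b) * m + (v + w) ≡ (a * m + v) + (b * m + w)
  regroup = solve-∀

ascentTransfer-const : ∀ p c d → ascentTransfer p (const c) d ≡ c * shuffles (suc p) d
ascentTransfer-const p c zero    = sym (*-identityʳ c)
ascentTransfer-const p c (suc d) rewrite ascentTransfer-const p c d = sym (*-distribˡ-+ c (shuffles p (suc d)) (shuffles (suc p) d))

transfer-cong : ∀ p {f g} → f ≗ g → transfer p f ≗ transfer p g
transfer-cong zero    f≗g d       = f≗g d
transfer-cong (suc p) f≗g zero    = transfer-cong p (f≗g ∘ suc) zero
transfer-cong (suc p) f≗g (suc d) = cong₂ _+_ (transfer-cong p (f≗g ∘ suc) (suc d)) (ascentTransfer-cong p (f≗g ∘ suc) d)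

transfer-zeroʳ : ∀ p f → transfer p f 0 ≡ f p
transfer-zeroʳ zero    f = refl
transfer-zeroʳ (suc p) f = transfer-zeroʳ p (f ∘ suc)

-- Linearity in the form the commutation uses: the constant is counted once for each shuffle.
transfer-+-const : ∀ p f c d → transfer p (λ x → f x + c) d ≡ transfer p f d + c * shuffles p d
transfer-+-const zero    f c d       = cong (f d +_) (sym (*-identityʳ c))
transfer-+-const (suc p) f c zero
  rewrite transfer-+-const p (f ∘ suc) c zero | shuffles-zeroʳ p = refl
transfer-+-const (suc p) f c (suc d)
  rewrite transfer-+-const p (f ∘ suc) c (suc d) | ascentTransfer-+ p (f ∘ suc) (const c) d | ascentTransfer-const p c d =
  regroup (transfer p (f ∘ suc) (suc d)) c (shuffles p (suc d)) (ascentTransfer p (f ∘ suc) d) (shuffles (suc p) d)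
  where
  regroup : ∀ t c m v n → (t + c * m) + (v + c * n) ≡ (t + v) + c * (m + n)
  regroup = solve-∀

-- The definition splits off the last term of the partial sum, this lemma the first. A shift of the
-- argument thus costs only the constant `f 1`.
transfer₁-suc : ∀ f d → transfer₁ f (suc d) ≡ transfer₁ (f ∘ suc) d + f 1
transfer₁-suc f zero    = +-comm (f 1) (f 2)
transfer₁-suc f (suc d) rewrite transfer₁-suc f d = regroup (transfer₁ (f ∘ suc) d) (f 1) (f (3 + d))
  where
  regroup : ∀ a b c → a + b + c ≡ a + c + b
  regroup = solve-∀

transfer-transfer₁-suc : ∀ p f d → transfer p (transfer₁ f ∘ suc) d ≡ transfer p (transfer₁ (f ∘ suc)) d + f 1 * shuffles p d
transfer-transfer₁-suc p f d = trans (transfer-cong p (transfer₁-suc f) d) (transfer-+-const p (transfer₁ (f ∘ suc)) (f 1) d)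

-- A single new letter in front makes the run d + 1; behind j > 0 letters of the run it leaves a run
-- of j. The two recursions list these terms in different orders.
transfer-one : ∀ f d → transfer 1 f d ≡ transfer₁ f d
transfer-one f zero    = refl
transfer-one f (suc d) = begin
  f (2 + d) + ascentTransfer 0 (f ∘ suc) d ≡⟨ +-comm (f (2 + d)) _ ⟩
  ascentTransfer 0 (f ∘ suc) d + f (2 + d) ≡⟨ ascentTransfer-zero (f ∘ suc) d ⟩
  f 1 + transfer₁ (f ∘ suc) d         ≡⟨ +-comm (f 1) _ ⟩
  transfer₁ (f ∘ suc) d + f 1         ≡⟨ transfer₁-suc f d ⟨
  transfer₁ f (suc d)                 ∎
  where
  open ≡-Reasoning
  ascentTransfer-zero : ∀ g d → ascentTransfer 0 g d + g (suc d) ≡ g 0 + transfer₁ g d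
  ascentTransfer-zero g zero    = refl
  ascentTransfer-zero g (suc d) = begin
    g 0 * 1 + ascentTransfer 0 (g ∘ suc) d + g (2 + d)   ≡⟨ +-assoc (g 0 * 1) _ _ ⟩
    g 0 * 1 + (ascentTransfer 0 (g ∘ suc) d + g (2 + d)) ≡⟨ cong₂ _+_ (*-identityʳ (g 0)) (ascentTransfer-zero (g ∘ suc) d) ⟩
    g 0 + (g 1 + transfer₁ (g ∘ suc) d)             ≡⟨ cong (g 0 +_) (trans (+-comm (g 1) _) (sym (transfer₁-suc g d))) ⟩
    g 0 + transfer₁ g (suc d)                       ∎

-- With a single old letter the run is one more than the number of copies before it, hence takes
-- each value from 1 to p + 1 once.
transfer-at-one : ∀ p f → transfer p f 1 ≡ transfer₁ f p
transfer-at-one zero    f = refl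
transfer-at-one (suc p) f = trans (cong (_+ f 1) (transfer-at-one p (f ∘ suc))) (sym (transfer₁-suc f p))

-- `transfer₁ (transfer p f)` grows by `transfer p f (2 + d)` between d and d + 1; the commutation
-- demands the same growth of `transfer p (transfer₁ f)`. In the induction on p, `transfer₁ f ∘ suc`
-- splits into `transfer₁ (f ∘ suc)` and the constant `f 1`, and the remaining terms match
-- coefficient by coefficient.
transfer-step : ∀ p f d → transfer p f (2 + d) + transfer p (transfer₁ f) d ≡ transfer p (transfer₁ f) (1 + d)
transfer-step zero    f d = +-comm (f (2 + d)) (transfer₁ f d)
transfer-step (suc p) f zero
  rewrite transfer-transfer₁-suc p f 0 | transfer-transfer₁-suc p f 1 | sym (transfer-step p (f ∘ suc) 0) | shuffles-zeroʳ p =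
  regroup (transfer p (f ∘ suc) 2) (f 1) (f 2) (shuffles p 1) (transfer p (transfer₁ (f ∘ suc)) 0)
  where
  regroup : ∀ t a b m s → (t + (a * m + b)) + (s + a * 1) ≡ ((t + s) + a * m) + (a + b)
  regroup = solve-∀
transfer-step (suc p) f (suc d)
  rewrite transfer-transfer₁-suc p f (1 + d) | transfer-transfer₁-suc p f (2 + d) | sym (transfer-step p (f ∘ suc) (1 + d))
        | ascentTransfer-+ p (transfer₁ f ∘ suc) (λ s → f (3 + s)) d =
  regroup (transfer p (f ∘ suc) (3 + d)) (f 1) (f 2) (shuffles p (2 + d)) (shuffles p (1 + d)) (ascentTransfer p (λ s → f (3 + s)) d)
        (transfer p (transfer₁ (f ∘ suc)) (1 + d)) (ascentTransfer p (transfer₁ f ∘ suc) d)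
  where
  regroup : ∀ t a b m n v s w →
    (t + (a * m + (b * n + v))) + ((s + a * n) + w) ≡ ((t + s) + a * m) + ((a + b) * n + (w + v))
  regroup = solve-∀

-- At d = 0 both sides are `transfer₁ f p`; from there `transfer-step` matches the increments.
transfer₁-transfer-comm : ∀ p f d → transfer₁ (transfer p f) d ≡ transfer p (transfer₁ f) d
transfer₁-transfer-comm p f zero    = trans (transfer-at-one p f) (sym (transfer-zeroʳ p (transfer₁ f)))
transfer₁-transfer-comm p f (suc d) = trans (cong (_+ transfer p f (2 + d)) (transfer₁-transfer-comm p f d))
                             (trans (+-comm (transfer p (transfer₁ f) d) _) (transfer-step p f d))

-- Ballot numbers

-- The m-th generation below a node d in the Catalan tree, where a node d has children 1, ..., d +
-- 1. Equivalently, paths with m + d up-steps and m down-steps that never go below 0.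
ballot : ℕ → ℕ → ℕ
ballot zero    = const 1
ballot (suc m) = transfer₁ (ballot m)

-- The ratio rule for neighbouring entries of a row, (k + 1) C(n, k + 1) = (n - k) C(n, k), freed of
-- subtraction.
C-absorption : ∀ n k → suc k * (n C suc k) + k * (n C k) ≡ n * (n C k)
C-absorption zero    zero    = refl
C-absorption zero    (suc k) rewrite *-zeroʳ k = refl
C-absorption (suc n) zero    rewrite nC1≡n (suc n) = regroup n
  where
  regroup : ∀ n → 1 * suc n + 0 ≡ suc n * 1
  regroup = solve-∀
C-absorption (suc n) (suc k)
  rewrite sym (nCk+nC[k+1]≡[n+1]C[k+1] n (suc k)) | sym (nCk+nC[k+1]≡[n+1]C[k+1] n k) = begin
  (2 + k) * (b + c) + (1 + k) * (a + b)                     ≡⟨ regroup₁ k a b c ⟩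
  (suc k * b + k * a) + (a + b + ((2 + k) * c + suc k * b)) ≡⟨ cong₂ (λ x y → x + (a + b + y)) (C-absorption n k) (C-absorption n (suc k)) ⟩
  n * a + (a + b + n * b)                                   ≡⟨ regroup₂ n a b ⟩
  suc n * (a + b)                                           ∎
  where
  open ≡-Reasoning
  a = n C k
  b = n C suc k
  c = n C suc (suc k)
  regroup₁ : ∀ k a b c → (2 + k) * (b + c) + (1 + k) * (a + b) ≡ (suc k * b + k * a) + (a + b + ((2 + k) * c + suc k * b))
  regroup₁ = solve-∀
  regroup₂ : ∀ n a b → n * a + (a + b + n * b) ≡ suc n * (a + b)
  regroup₂ = solve-∀

-- n C-pred m is n C (m - 1), with value 0 at m = 0.
_C-pred_ : ℕ → ℕ → ℕ
n C-pred zero  = 0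
n C-pred suc m = n C m

C-pascal : ∀ n m → suc n C m ≡ (n C-pred m) + n C m
C-pascal n zero    = refl
C-pascal n (suc m) = sym (nCk+nC[k+1]≡[n+1]C[k+1] n m)

C-central : ∀ m → suc (2 * m) C suc m ≡ suc (2 * m) C m
C-central m = trans (nCk≡nC[n∸k] (s≤s (m≤n*m m 2))) (cong (suc (2 * m) C_) (trans (cong (_∸ m) (cong (m +_) (+-identityʳ m))) (m+n∸m≡n m m)))

-- The difference of binomials from the reflection principle, with the subtrahend moved to the left.
-- By Pascal both binomials obey the recursion of `ballot`, since the pairs (m, 2 + d) and (suc m,
-- d) belong to the same row; the boundary d = 0 closes by the symmetry `C-central`.
ballot-reflection : ∀ m d → ballot m d + ((2 * m + d) C-pred m) ≡ (2 * m + d) C m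
ballot-reflection zero    d = refl
ballot-reflection (suc m) zero = subst (λ n → ballot (suc m) 0 + n C m ≡ n C suc m) (regroup m) (begin
  ballot m 1 + suc N C m             ≡⟨ cong (ballot m 1 +_) (C-pascal N m) ⟩
  ballot m 1 + ((N C-pred m) + N C m)  ≡⟨ +-assoc (ballot m 1) (N C-pred m) (N C m) ⟨
  ballot m 1 + (N C-pred m) + N C m    ≡⟨ cong (_+ N C m) (subst (λ n → ballot m 1 + (n C-pred m) ≡ n C m) (+-comm (2 * m) 1) (ballot-reflection m 1)) ⟩
  N C m + N C m                 ≡⟨ cong (N C m +_) (C-central m) ⟨
  N C m + N C suc m             ≡⟨ C-pascal N (suc m) ⟨
  suc N C suc m                 ∎)
  where
  open ≡-Reasoning
  N = suc (2 * m)
  regroup : ∀ m → 2 + 2 * m ≡ 2 * suc m + 0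
  regroup = solve-∀
ballot-reflection (suc m) (suc d) = subst (λ n → ballot (suc m) (suc d) + n C m ≡ n C suc m) (sym (+-suc (2 * suc m) d)) (begin
  ballot (suc m) d + ballot m (2 + d) + suc N C m                   ≡⟨ cong (ballot (suc m) d + ballot m (2 + d) +_) (C-pascal N m) ⟩
  ballot (suc m) d + ballot m (2 + d) + ((N C-pred m) + N C m)        ≡⟨ regroup (ballot (suc m) d) (ballot m (2 + d)) (N C-pred m) (N C m) ⟩
  (ballot m (2 + d) + (N C-pred m)) + (ballot (suc m) d + N C m)      ≡⟨ cong₂ _+_ (subst (λ n → ballot m (2 + d) + (n C-pred m) ≡ n C m) (shift m d) (ballot-reflection m (2 + d))) (ballot-reflection (suc m) d) ⟩
  N C m + N C suc m                                       ≡⟨ C-pascal N (suc m) ⟨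
  suc N C suc m                                           ∎)
  where
  open ≡-Reasoning
  N = 2 * suc m + d
  regroup : ∀ a b c e → a + b + (c + e) ≡ (b + c) + (a + e)
  regroup = solve-∀
  shift : ∀ m d → 2 * m + (2 + d) ≡ 2 * suc m + d
  shift = solve-∀

ballot-formula : ∀ m d → ballot m d * suc (m + d) ≡ suc d * ((2 * m + d) C m)
ballot-formula zero    d = regroup d
  where
  regroup : ∀ d → 1 * suc d ≡ suc d * 1
  regroup = solve-∀
-- The added summand is the left side of `C-absorption`. Exchanged for `N * a`, it supplies the
-- multiple of `a` that completes `ballot (suc m) d` to `b` by reflection.
ballot-formula (suc m) d = +-cancelʳ-≡ (suc m * b + m * a) _ _ (begin
  ballot (suc m) d * suc (suc m + d) + (suc m * b + m * a) ≡⟨ cong (ballot (suc m) d * suc (suc m + d) +_) (C-absorption N m) ⟩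
  ballot (suc m) d * suc (suc m + d) + N * a               ≡⟨ regroup₁ (ballot (suc m) d) m d a ⟩
  (ballot (suc m) d + a) * (2 + m + d) + m * a             ≡⟨ cong (λ x → x * (2 + m + d) + m * a) (ballot-reflection (suc m) d) ⟩
  b * (2 + m + d) + m * a                             ≡⟨ regroup₂ m d a b ⟩
  suc d * b + (suc m * b + m * a)                     ∎)
  where
  open ≡-Reasoning
  N = 2 * suc m + d
  a = N C m
  b = N C suc m
  regroup₁ : ∀ f m d a → f * suc (suc m + d) + (2 * suc m + d) * a ≡ (f + a) * (2 + m + d) + m * a
  regroup₁ = solve-∀
  regroup₂ : ∀ m d a b → b * (2 + m + d) + m * a ≡ suc d * b + (suc m * b + m * a)
  regroup₂ = solve-∀

-- Enumerations

module _ {X Y : Set} where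

  -- Injectivity is asked on the list only, because `interleave` and `blocks` lose information
  -- outside their intended arguments.
  Unique-map : (f : X → Y) {xs : List X} →
    (∀ {x y} → x ∈ xs → y ∈ xs → f x ≡ f y → x ≡ y) → Unique xs → Unique (map f xs)
  Unique-map f inj []              = []
  Unique-map f inj (x≢xs ∷ unique) =
    All.tabulate (λ fy∈ fx≡ → let y , y∈ , eq = ∈-map⁻ f fy∈ in
      All.lookup x≢xs y∈ (inj (here refl) (there y∈) (trans fx≡ eq)))
    ∷ Unique-map f (λ x∈ y∈ → inj (there x∈) (there y∈)) unique

  ∈-concatMap⁺′ : (f : X → List Y) {xs : List X} {x : X} {y : Y} → x ∈ xs → y ∈ f x → y ∈ concatMap f xs
  ∈-concatMap⁺′ f x∈ y∈ = ∈-concatMap⁺ f (lose x∈ y∈)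

  ∈-concatMap⁻′ : (f : X → List Y) {xs : List X} {y : Y} → y ∈ concatMap f xs → ∃ λ x → x ∈ xs × y ∈ f x
  ∈-concatMap⁻′ f {xs} y∈ = find (∈-concatMap⁻ f {xs} y∈)

  Unique-concatMap : (f : X → List Y) {xs : List X} → (∀ {x} → x ∈ xs → Unique (f x)) →
    (∀ {x x′ y} → x ∈ xs → x′ ∈ xs → y ∈ f x → y ∈ f x′ → x ≡ x′) → Unique xs → Unique (concatMap f xs)
  Unique-concatMap f uniq inj []              = []
  Unique-concatMap f {x ∷ xs} uniq inj (x≢xs ∷ unique) =
    Unique.++⁺ (uniq (here refl))
      (Unique-concatMap f (uniq ∘ there) (λ x∈ x′∈ → inj (there x∈) (there x′∈)) unique)
      (λ (y∈ , y∈′) → let x′ , x′∈ , y∈x′ = ∈-concatMap⁻′ f {xs} y∈′ in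
        All.lookup x≢xs x′∈ (inj (here refl) (there x′∈) y∈ y∈x′))

∑ : {X : Set} → (X → ℕ) → List X → ℕ
∑ f xs = sum (map f xs)

module _ {X : Set} where

  ∑-++ : (f : X → ℕ) (xs ys : List X) → ∑ f (xs ++ ys) ≡ ∑ f xs + ∑ f ys
  ∑-++ f xs ys = trans (cong sum (map-++ f xs ys)) (sum-++ (map f xs) (map f ys))

  ∑-cong : {f g : X → ℕ} (xs : List X) → (∀ {x} → x ∈ xs → f x ≡ g x) → ∑ f xs ≡ ∑ g xs
  ∑-cong []       f≡g = refl
  ∑-cong (x ∷ xs) f≡g = cong₂ _+_ (f≡g (here refl)) (∑-cong xs (f≡g ∘ there))

  ∑-const : (c : ℕ) (xs : List X) → ∑ (const c) xs ≡ c * length xs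
  ∑-const c []       = sym (*-zeroʳ c)
  ∑-const c (x ∷ xs) = trans (cong (c +_) (∑-const c xs)) (sym (*-suc c (length xs)))

module _ {X Y : Set} where

  ∑-map : (f : Y → ℕ) (g : X → Y) (xs : List X) → ∑ f (map g xs) ≡ ∑ (f ∘ g) xs
  ∑-map f g xs = cong sum (sym (map-∘ xs))

  ∑-concatMap : (f : Y → ℕ) (g : X → List Y) (xs : List X) → ∑ f (concatMap g xs) ≡ ∑ (∑ f ∘ g) xs
  ∑-concatMap f g []       = refl
  ∑-concatMap f g (x ∷ xs) = trans (∑-++ f (g x) (concatMap g xs)) (cong (∑ f (g x) +_) (∑-concatMap f g xs))

-- Avoidance and initial runs in words

-- No y < z occur in this order in the word with x < y.
Avoids23 : ℕ → List ℕ → Set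
Avoids23 x []      = ⊤
Avoids23 x (y ∷ w) = (x < y → All (_≤ y) w) × Avoids23 x w

Avoids : List ℕ → Set
Avoids []      = ⊤
Avoids (x ∷ w) = Avoids23 x w × Avoids w

bounded⇒avoids23 : ∀ {x} w → All (_≤ x) w → Avoids23 x w
bounded⇒avoids23 []      []          = _
bounded⇒avoids23 (y ∷ w) (y≤x ∷ all) = (λ x<y → contradiction y≤x (<⇒≱ x<y)) , bounded⇒avoids23 w all

below : ℕ → List ℕ → ℕ
below x []      = 0
below x (y ∷ w) with y ≤? x
... | yes _ = suc (below x w)
... | no  _ = 0

-- The length of the initial weakly decreasing run: when the head y of w is at most x, run w ≤ below x w;
-- otherwise below x w = 0. In this form a site condition for run splits by admissible-⊓⁺.
run : List ℕ → ℕ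
run []      = 0
run (x ∷ w) = suc (below x w ⊓ run w)

run≤length : ∀ w → run w ≤ length w
run≤length []      = z≤n
run≤length (x ∷ w) = s≤s (≤-trans (m⊓n≤n (below x w) (run w)) (run≤length w))

below-all : ∀ {x} w → All (_≤ x) w → below x w ≡ length w
below-all []      []         = refl
below-all {x} (y ∷ w) (y≤x ∷ all) with y ≤? x
... | yes _  = cong suc (below-all w all)
... | no y≰x = contradiction y≤x y≰x

-- u arises from w by inserting copies of the new largest letter k at the trues of the mask S.
data Interleaving (k : ℕ) : List Bool → List ℕ → List ℕ → Set where
  []  : Interleaving k [] [] []
  new : ∀ {S w u} → Interleaving k S w u → Interleaving k (true ∷ S) w (k ∷ u)
  old : ∀ {S w u x} → x < k → Interleaving k S w u → Interleaving k (false ∷ S) (x ∷ w) (x ∷ u)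

-- No true is preceded by more than d falses.
data Admissible : ℕ → List Bool → Set where
  []   : ∀ {d} → Admissible d []
  new  : ∀ {d S} → Admissible d S → Admissible d (true ∷ S)
  old  : ∀ {d S} → Admissible d S → Admissible (suc d) (false ∷ S)
  stop : ∀ {S} → All (_≡ false) S → Admissible 0 (false ∷ S)

allFalse⇒admissible : ∀ d {S} → All (_≡ false) S → Admissible d S
allFalse⇒admissible d       []           = []
allFalse⇒admissible zero    (refl ∷ all) = stop all
allFalse⇒admissible (suc d) (refl ∷ all) = old (allFalse⇒admissible d all)

admissible-⊓⁺ : ∀ {d e S} → Admissible d S → Admissible e S → Admissible (d ⊓ e) S
admissible-⊓⁺ []         _          = []
admissible-⊓⁺ (new a)    (new b)    = new (admissible-⊓⁺ a b)
admissible-⊓⁺ (old a)    (old b)    = old (admissible-⊓⁺ a b)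
admissible-⊓⁺ (old a)    (stop all) = stop all
admissible-⊓⁺ (stop all) _          = stop all

admissible-mono : ∀ {d e S} → d ≤ e → Admissible d S → Admissible e S
admissible-mono d≤e       []         = []
admissible-mono d≤e       (new a)    = new (admissible-mono d≤e a)
admissible-mono (s≤s d≤e) (old a)    = old (admissible-mono d≤e a)
admissible-mono d≤e       (stop all) = allFalse⇒admissible _ (refl ∷ all)

module _ {k : ℕ} where

  letters≤ : ∀ {S w u} → Interleaving k S w u → All (_≤ k) u
  letters≤ []          = []
  letters≤ (new I)     = ≤-refl ∷ letters≤ I
  letters≤ (old x<k I) = <⇒≤ x<k ∷ letters≤ I

  bounded⁻ : ∀ {b S w u} → b < k → Interleaving k S w u → All (_≤ b) u → All (_≤ b) w × All (_≡ false) S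
  bounded⁻ b<k []        []          = [] , []
  bounded⁻ b<k (new I)   (k≤b ∷ all) = contradiction k≤b (<⇒≱ b<k)
  bounded⁻ b<k (old _ I) (x≤b ∷ all) with all-w , all-S ← bounded⁻ b<k I all = x≤b ∷ all-w , refl ∷ all-S

  bounded⁺ : ∀ {b S w u} → Interleaving k S w u → All (_≤ b) w → All (_≡ false) S → All (_≤ b) u
  bounded⁺ []        []          []          = []
  bounded⁺ (new I)   _           (() ∷ _)
  bounded⁺ (old _ I) (x≤b ∷ all) (_ ∷ all-S) = x≤b ∷ bounded⁺ I all all-S

  -- Once an old letter y > x has passed, a later copy of `k` would complete x < y < k; so copies
  -- end with the prefix measured by `below x w`.
  avoids23⁻ : ∀ {x S w u} → x < k → Interleaving k S w u →
    Avoids23 x u → Avoids23 x w × Admissible (below x w) S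
  avoids23⁻ x<k []      _       = _ , []
  avoids23⁻ x<k (new I) (_ , a) with b , c ← avoids23⁻ x<k I a = b , new c
  avoids23⁻ {x} x<k (old {x = y} y<k I) (above , a) with avoids23⁻ x<k I a | y ≤? x
  ... | b , c | yes y≤x = ((λ x<y → contradiction y≤x (<⇒≱ x<y)) , b) , old c
  ... | b , c | no  y≰x with all-w , all-S ← bounded⁻ y<k I (above (≰⇒> y≰x)) = ((λ _ → all-w) , b) , stop all-S

  avoids23⁺ : ∀ {x S w u} → x < k → Interleaving k S w u →
    Avoids23 x w → Admissible (below x w) S → Avoids23 x u
  avoids23⁺ x<k []      _ _       = _
  avoids23⁺ x<k (new I) b (new c) = (λ _ → letters≤ I) , avoids23⁺ x<k I b c
  avoids23⁺ {x} x<k (old {x = y} y<k I) (above , b) c with y ≤? x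
  avoids23⁺ {x} x<k (old {x = y} y<k I) (above , b) (old c)    | yes y≤x =
    (λ x<y → contradiction y≤x (<⇒≱ x<y)) , avoids23⁺ x<k I b c
  avoids23⁺ {x} x<k (old {x = y} y<k I) (above , b) (stop all) | no  y≰x =
    (λ x<y → bounded⁺ I (above x<y) all) , avoids23⁺ x<k I b (allFalse⇒admissible _ all)

  -- An old head x restricts the later copies twice: as the start of an ascent, by `below x w`, and
  -- through the tail, by `run w`. The minimum in `run` combines the two.
  avoids⁻ : ∀ {S w u} → Interleaving k S w u → Avoids u → Avoids w × Admissible (run w) S
  avoids⁻ []          _       = _ , []
  avoids⁻ (new I)     (_ , a) with b , c ← avoids⁻ I a = b , new c
  avoids⁻ (old x<k I) (a₂ , a₃) with b₂ , c₂ ← avoids23⁻ x<k I a₂ | b₃ , c₃ ← avoids⁻ I a₃ =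
    (b₂ , b₃) , old (admissible-⊓⁺ c₂ c₃)

  avoids⁺ : ∀ {S w u} → Interleaving k S w u → Avoids w → Admissible (run w) S → Avoids u
  avoids⁺ []          _         _       = _
  avoids⁺ (new I)     b         (new c) = bounded⇒avoids23 _ (letters≤ I) , avoids⁺ I b c
  avoids⁺ (old {w = w} {x = x} x<k I) (b₂ , b₃) (old c) =
    avoids23⁺ x<k I b₂ (admissible-mono (m⊓n≤m (below x w) (run w)) c) ,
    avoids⁺ I b₃ (admissible-mono (m⊓n≤n (below x w) (run w)) c)

leadingFalses : List Bool → ℕ
leadingFalses []          = 0
leadingFalses (true  ∷ S) = 0
leadingFalses (false ∷ S) = suc (leadingFalses S)

-- Run length after inserting along a mask into a word with run length d.
newRun : ℕ → List Bool → ℕ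
newRun d []          = 0
newRun d (true  ∷ S) = suc (newRun d S)
newRun d (false ∷ S) = suc (leadingFalses S) ⊓ d

-- Under an old head only the part of the tail before the first copy matters, and up to there the
-- tail runs as it did before the insertion.
leadingFalses-⊓-newRun : ∀ d S → leadingFalses S ⊓ newRun d S ≡ leadingFalses S ⊓ d
leadingFalses-⊓-newRun d []          = refl
leadingFalses-⊓-newRun d (true ∷ S)  = refl
leadingFalses-⊓-newRun d (false ∷ S) =
  trans (sym (⊓-assoc l l d)) (cong (_⊓ d) (⊓-idem l))
  where l = suc (leadingFalses S)

module _ {k : ℕ} where

  below-interleaving : ∀ {x S w u} → x < k → Interleaving k S w u → below x u ≡ leadingFalses S ⊓ below x w
  below-interleaving     x<k []  = refl
  below-interleaving {x} x<k (new I) with k ≤? x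
  ... | yes k≤x = contradiction k≤x (<⇒≱ x<k)
  ... | no  _   = refl
  below-interleaving {x} x<k (old {x = y} _ I) with y ≤? x
  ... | yes _ = cong suc (below-interleaving x<k I)
  ... | no  _ = refl

  -- A copy at the front prolongs the run by one, since every letter is at most `k`; behind an old
  -- letter the first copy is an ascent and ends the run.
  run-interleaving : ∀ {S w u} → Interleaving k S w u → run u ≡ newRun (run w) S
  run-interleaving []  = refl
  run-interleaving (new {u = u} I) rewrite below-all u (letters≤ I) =
    cong suc (trans (m≥n⇒m⊓n≡n (run≤length u)) (run-interleaving I))
  run-interleaving (old {S = S} {w = w} {u = u} {x = x} x<k I)
    rewrite below-interleaving x<k I | run-interleaving I = cong suc (begin
    (l ⊓ below x w) ⊓ newRun (run w) S ≡⟨ cong (_⊓ newRun (run w) S) (⊓-comm l (below x w)) ⟩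
    (below x w ⊓ l) ⊓ newRun (run w) S ≡⟨ ⊓-assoc (below x w) l _ ⟩
    below x w ⊓ (l ⊓ newRun (run w) S) ≡⟨ cong (below x w ⊓_) (leadingFalses-⊓-newRun (run w) S) ⟩
    below x w ⊓ (l ⊓ run w)            ≡⟨ ⊓-assoc (below x w) l _ ⟨
    (below x w ⊓ l) ⊓ run w            ≡⟨ cong (_⊓ run w) (⊓-comm (below x w) l) ⟩
    (l ⊓ below x w) ⊓ run w            ≡⟨ ⊓-assoc l (below x w) (run w) ⟩
    l ⊓ (below x w ⊓ run w)            ∎)
    where
    open ≡-Reasoning
    l = leadingFalses S

-- Masks with a given number of copies, and sums over them

trues : List Bool → ℕ
trues []          = 0
trues (true  ∷ S) = suc (trues S)
trues (false ∷ S) = trues S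

falses : List Bool → ℕ
falses []          = 0
falses (true  ∷ S) = falses S
falses (false ∷ S) = suc (falses S)

-- Masks with p trues that all precede the last r of the d + r falses.
masks : ℕ → ℕ → ℕ → List (List Bool)
masks zero    d       r = replicate (d + r) false ∷ []
masks (suc p) zero    r = map (true ∷_) (masks p zero r)
masks (suc p) (suc d) r = map (true ∷_) (masks p (suc d) r) ++ map (false ∷_) (masks (suc p) d r)

record IsMask (p d r : ℕ) (S : List Bool) : Set where
  constructor isMask
  field
    admissible : Admissible d S
    trues≡     : trues S ≡ p
    falses≡    : falses S ≡ d + r

masks-sound : ∀ p d r {S} → S ∈ masks p d r → IsMask p d r S
masks-sound zero d r (here refl) = isMask (adm d) (tr (d + r)) (fa (d + r))
  where
  tr : ∀ n → trues (replicate n false) ≡ 0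
  tr zero    = refl
  tr (suc n) = tr n
  fa : ∀ n → falses (replicate n false) ≡ n
  fa zero    = refl
  fa (suc n) = cong suc (fa n)
  all : ∀ n → All (_≡ false) (replicate n false)
  all zero    = []
  all (suc n) = refl ∷ all n
  adm : ∀ d → Admissible d (replicate (d + r) false)
  adm d = allFalse⇒admissible d (all (d + r))
masks-sound (suc p) zero r S∈ with _ , S′∈ , refl ← ∈-map⁻ (true ∷_) S∈
  with isMask a t f ← masks-sound p zero r S′∈ = isMask (new a) (cong suc t) f
masks-sound (suc p) (suc d) r S∈ with ∈-++⁻ (map (true ∷_) (masks p (suc d) r)) S∈
... | inj₁ S∈′ with _ , S′∈ , refl ← ∈-map⁻ (true ∷_) S∈′
  with isMask a t f ← masks-sound p (suc d) r S′∈ = isMask (new a) (cong suc t) f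
... | inj₂ S∈′ with _ , S′∈ , refl ← ∈-map⁻ (false ∷_) S∈′
  with isMask a t f ← masks-sound (suc p) d r S′∈ = isMask (old a) t (cong suc f)

allFalse⇒trues≡0 : ∀ {S} → All (_≡ false) S → trues S ≡ 0
allFalse⇒trues≡0 []           = refl
allFalse⇒trues≡0 (refl ∷ all) = allFalse⇒trues≡0 all

trues≡0⇒replicate : ∀ S → trues S ≡ 0 → S ≡ replicate (falses S) false
trues≡0⇒replicate []          _ = refl
trues≡0⇒replicate (false ∷ S) t = cong (false ∷_) (trues≡0⇒replicate S t)

masks-complete : ∀ p d r {S} → IsMask p d r S → S ∈ masks p d r
masks-complete zero    d r {S} (isMask _ t f) = here (trans (trues≡0⇒replicate S t) (cong (λ n → replicate n false) f))
masks-complete (suc p) zero r (isMask (new a) t f) =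
  ∈-map⁺ (true ∷_) (masks-complete p zero r (isMask a (suc-injective t) f))
masks-complete (suc p) zero r (isMask (stop all) t f) = contradiction (trans (sym t) (allFalse⇒trues≡0 all)) λ ()
masks-complete (suc p) (suc d) r (isMask (new a) t f) =
  ∈-++⁺ˡ (∈-map⁺ (true ∷_) (masks-complete p (suc d) r (isMask a (suc-injective t) f)))
masks-complete (suc p) (suc d) r (isMask (old a) t f) =
  ∈-++⁺ʳ _ (∈-map⁺ (false ∷_) (masks-complete (suc p) d r (isMask a t (suc-injective f))))

masks-unique : ∀ p d r → Unique (masks p d r)
masks-unique zero    d       r = [] ∷ []
masks-unique (suc p) zero    r = Unique.map⁺ ∷-injectiveʳ (masks-unique p zero r)
masks-unique (suc p) (suc d) r = Unique.++⁺
  (Unique.map⁺ ∷-injectiveʳ (masks-unique p (suc d) r))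
  (Unique.map⁺ ∷-injectiveʳ (masks-unique (suc p) d r))
  λ (S∈ , S∈′) → disjoint (∈-map⁻ (true ∷_) S∈) (∈-map⁻ (false ∷_) S∈′)
  where
  disjoint : ∀ {S} {P Q : List Bool → Set} → (∃ λ S′ → P S′ × S ≡ true ∷ S′) → ¬ (∃ λ S′ → Q S′ × S ≡ false ∷ S′)
  disjoint (_ , _ , refl) (_ , _ , ())

length-masks : ∀ p d r → length (masks p d r) ≡ shuffles p d
length-masks zero    d       r = refl
length-masks (suc p) zero    r = trans (length-map _ (masks p zero r)) (trans (length-masks p zero r) (shuffles-zeroʳ p))
length-masks (suc p) (suc d) r =
  trans (length-++ (map (true ∷_) (masks p (suc d) r)))
    (cong₂ _+_ (trans (length-map _ (masks p (suc d) r)) (length-masks p (suc d) r))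
               (trans (length-map _ (masks (suc p) d r)) (length-masks (suc p) d r)))

-- There is a first copy, as `suc p` are placed. If it stands in front, each placement of the other
-- p contributes `g 0`; otherwise one old letter is passed and `g` shifts.
∑-leadingFalses : ∀ p d r (g : ℕ → ℕ) → ∑ (λ S → g (leadingFalses S ⊓ d)) (masks (suc p) d r) ≡ ascentTransfer p g d
∑-leadingFalses p zero r g = begin
  ∑ (λ S → g (leadingFalses S ⊓ 0)) (map (true ∷_) (masks p 0 r)) ≡⟨ ∑-map _ (true ∷_) (masks p 0 r) ⟩
  ∑ (const (g 0)) (masks p 0 r)                                   ≡⟨ ∑-const (g 0) (masks p 0 r) ⟩
  g 0 * length (masks p 0 r)                                      ≡⟨ cong (g 0 *_) (trans (length-masks p 0 r) (shuffles-zeroʳ p)) ⟩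
  g 0 * 1                                                         ≡⟨ *-identityʳ (g 0) ⟩
  g 0                                                             ∎
  where open ≡-Reasoning
∑-leadingFalses p (suc d) r g = begin
  ∑ h (map (true ∷_) (masks p (suc d) r) ++ map (false ∷_) (masks (suc p) d r))
    ≡⟨ ∑-++ h (map (true ∷_) (masks p (suc d) r)) _ ⟩
  ∑ h (map (true ∷_) (masks p (suc d) r)) + ∑ h (map (false ∷_) (masks (suc p) d r))
    ≡⟨ cong₂ _+_ (∑-map h (true ∷_) (masks p (suc d) r)) (∑-map h (false ∷_) (masks (suc p) d r)) ⟩
  ∑ (const (g 0)) (masks p (suc d) r) + ∑ (λ S → g (suc (leadingFalses S ⊓ d))) (masks (suc p) d r)
    ≡⟨ cong₂ _+_ (trans (∑-const (g 0) (masks p (suc d) r)) (cong (g 0 *_) (length-masks p (suc d) r)))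
                 (∑-leadingFalses p d r (g ∘ suc)) ⟩
  g 0 * shuffles p (suc d) + ascentTransfer p (g ∘ suc) d ∎
  where
  open ≡-Reasoning
  h = λ S → g (leadingFalses S ⊓ suc d)

newRun-replicate : ∀ d r → newRun d (replicate (d + r) false) ≡ d
newRun-replicate zero    zero    = refl
newRun-replicate zero    (suc r) = refl
newRun-replicate (suc d) r       = cong suc (trans (cong (_⊓ d) (leading (d + r))) (m≥n⇒m⊓n≡n (m≤m+n d r)))
  where
  leading : ∀ n → leadingFalses (replicate n false) ≡ n
  leading zero    = refl
  leading (suc n) = cong suc (leading n)

-- The r old letters beyond the run have no copy between or behind them, so the sum sees the word
-- only through d.
∑-newRun : ∀ p d r (f : ℕ → ℕ) → ∑ (f ∘ newRun d) (masks p d r) ≡ transfer p f d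
∑-newRun zero    d       r f = trans (+-identityʳ _) (cong f (newRun-replicate d r))
∑-newRun (suc p) zero    r f = trans (∑-map _ (true ∷_) (masks p zero r)) (∑-newRun p zero r (f ∘ suc))
∑-newRun (suc p) (suc d) r f = trans (∑-++ _ (map (true ∷_) (masks p (suc d) r)) _)
  (cong₂ _+_ (trans (∑-map _ (true ∷_) (masks p (suc d) r)) (∑-newRun p (suc d) r (f ∘ suc)))
             (trans (∑-map _ (false ∷_) (masks (suc p) d r)) (∑-leadingFalses p d r (f ∘ suc))))

-- Avoiding words with given content

occ : ℕ → List ℕ → ℕ
occ a []      = 0
occ a (x ∷ w) = if does (x ≟ a) then suc (occ a w) else occ a w

occ-≡ : ∀ a w → occ a (a ∷ w) ≡ suc (occ a w)
occ-≡ a w rewrite dec-true (a ≟ a) refl = refl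

occ-≢ : ∀ {a x} w → x ≢ a → occ a (x ∷ w) ≡ occ a w
occ-≢ {a} {x} w x≢a rewrite dec-false (x ≟ a) x≢a = refl

record AvoidingWord (c : ℕ → ℕ) (k : ℕ) (w : List ℕ) : Set where
  constructor avoidingWord
  field
    letters : All (_< k) w
    content : ∀ a → a < k → occ a w ≡ c a
    avoids  : Avoids w

-- The clause for an exhausted word is a junk value, excluded by the length condition of
-- `interleave-correct`.
interleave : ℕ → List Bool → List ℕ → List ℕ
interleave k []          w       = []
interleave k (true  ∷ S) w       = k ∷ interleave k S w
interleave k (false ∷ S) []      = []
interleave k (false ∷ S) (x ∷ w) = x ∷ interleave k S w

interleave-correct : ∀ {k} S {w} → All (_< k) w → falses S ≡ length w → Interleaving k S w (interleave k S w)
interleave-correct []          []          _ = []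
interleave-correct (true  ∷ S) all         f = new (interleave-correct S all f)
interleave-correct (false ∷ S) (x<k ∷ all) f = old x<k (interleave-correct S all (suc-injective f))

module _ {k : ℕ} where

  interleaving⇒interleave : ∀ {S w u} → Interleaving k S w u → u ≡ interleave k S w
  interleaving⇒interleave []        = refl
  interleaving⇒interleave (new I)   = cong (k ∷_) (interleaving⇒interleave I)
  interleaving⇒interleave (old _ I) = cong (_ ∷_) (interleaving⇒interleave I)

  -- Old letters are below `k`, so no entry of `u` can be read both as a copy and as an old letter.
  interleaving-injective : ∀ {S S′ w w′ u} → Interleaving k S w u → Interleaving k S′ w′ u → S ≡ S′ × w ≡ w′
  interleaving-injective []          []          = refl , refl
  interleaving-injective (new I)     (new J)     with refl , refl ← interleaving-injective I J = refl , refl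
  interleaving-injective (old _ I)   (old _ J)   with refl , refl ← interleaving-injective I J = refl , refl
  interleaving-injective (new _)     (old k<k _) = contradiction k<k (<-irrefl refl)
  interleaving-injective (old k<k _) (new _)     = contradiction k<k (<-irrefl refl)

  split : ∀ {u} → All (_< suc k) u → ∃₂ λ S w → Interleaving k S w u
  split []          = [] , [] , []
  split {x ∷ u} (s≤s x≤k ∷ all) with split all | x ≟ k
  ... | S , w , I | yes refl = true ∷ S , w , new I
  ... | S , w , I | no  x≢k  = false ∷ S , x ∷ w , old (≤∧≢⇒< x≤k x≢k) I

  old-letters : ∀ {S w u} → Interleaving k S w u → All (_< k) w
  old-letters []          = []
  old-letters (new I)     = old-letters I
  old-letters (old x<k I) = x<k ∷ old-letters I

  falses≡length : ∀ {S w u} → Interleaving k S w u → falses S ≡ length w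
  falses≡length []        = refl
  falses≡length (new I)   = falses≡length I
  falses≡length (old _ I) = cong suc (falses≡length I)

  length-interleaving : ∀ {S w u} → Interleaving k S w u → length u ≡ trues S + length w
  length-interleaving []        = refl
  length-interleaving (new I)   = cong suc (length-interleaving I)
  length-interleaving (old _ I) = trans (cong suc (length-interleaving I)) (sym (+-suc _ _))

  occ-new : ∀ {S w u} → Interleaving k S w u → occ k u ≡ trues S
  occ-new []                  = refl
  occ-new (new {u = u} I)     = trans (occ-≡ k u) (cong suc (occ-new I))
  occ-new (old {u = u} x<k I) = trans (occ-≢ u (<⇒≢ x<k)) (occ-new I)

  occ-old : ∀ {a S w u} → a < k → Interleaving k S w u → occ a u ≡ occ a w
  occ-old     a<k []                          = refl
  occ-old     a<k (new {u = u} I)             = trans (occ-≢ u (>⇒≢ a<k)) (occ-old a<k I)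
  occ-old {a} a<k (old {x = x} _ I) with does (x ≟ a)
  ... | true  = cong suc (occ-old a<k I)
  ... | false = occ-old a<k I

module _ (c : ℕ → ℕ) where

  extensions : ℕ → List ℕ → List (List ℕ)
  extensions k w = map (λ S → interleave k S w) (masks (c k) (run w) (length w ∸ run w))

  words : ℕ → List (List ℕ)
  words zero    = [] ∷ []
  words (suc k) = concatMap (extensions k) (words k)

  size : ℕ → ℕ
  size zero    = 0
  size (suc k) = c k + size k

  extensions⁻ : ∀ {k w u} → All (_< k) w → u ∈ extensions k w →
    ∃ λ S → IsMask (c k) (run w) (length w ∸ run w) S × Interleaving k S w u
  extensions⁻ {k} {w} all u∈ with S , S∈ , refl ← ∈-map⁻ (λ S → interleave k S w) u∈ =
    let mask = masks-sound (c k) (run w) _ S∈ in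
    S , mask , interleave-correct S all (trans (IsMask.falses≡ mask) (m+[n∸m]≡n (run≤length w)))

  words-sound : ∀ k {u} → u ∈ words k → AvoidingWord c k u
  words-sound zero    (here refl) = avoidingWord [] (λ a ()) _
  words-sound (suc k) {u} u∈
    with w , w∈ , u∈′ ← ∈-concatMap⁻′ (extensions k) {words k} u∈
    with avoidingWord letters content avoids ← words-sound k w∈
    with S , isMask admissible trues≡ _ , I ← extensions⁻ letters u∈′ =
    avoidingWord (All.map s≤s (letters≤ I)) content′ (avoids⁺ I avoids admissible)
    where
    content′ : ∀ a → a < suc k → occ a u ≡ c a
    content′ a (s≤s a≤k) with a ≟ k
    ... | yes refl = trans (occ-new I) trues≡
    ... | no  a≢k  = trans (occ-old (≤∧≢⇒< a≤k a≢k) I) (content a (≤∧≢⇒< a≤k a≢k))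

  words-complete : ∀ k {u} → AvoidingWord c k u → u ∈ words k
  words-complete zero    {[]}    _ = here refl
  words-complete zero    {_ ∷ _} (avoidingWord (() ∷ _) _ _)
  words-complete (suc k) (avoidingWord letters content avoids)
    with S , w , I ← split letters
    with avoids′ , admissible ← avoids⁻ I avoids =
    subst (_∈ words (suc k)) (sym (interleaving⇒interleave I)) (∈-concatMap⁺′ (extensions k)
      (words-complete k (avoidingWord (old-letters I)
        (λ a a<k → trans (sym (occ-old a<k I)) (content a (m<n⇒m<1+n a<k))) avoids′))
      (∈-map⁺ (λ S → interleave k S w) (masks-complete (c k) (run w) _
        (isMask admissible (trans (sym (occ-new I)) (content k ≤-refl))
          (trans (falses≡length I) (sym (m+[n∸m]≡n (run≤length w))))))))

  words-unique : ∀ k → Unique (words k)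
  words-unique zero    = [] ∷ []
  words-unique (suc k) = Unique-concatMap (extensions k) extensions-unique extensions-disjoint (words-unique k)
    where
    letters : ∀ {w} → w ∈ words k → All (_< k) w
    letters = AvoidingWord.letters ∘ words-sound k
    extensions-unique : ∀ {w} → w ∈ words k → Unique (extensions k w)
    extensions-unique {w} w∈ = Unique-map _
      (λ S∈ S′∈ eq → proj₁ (interleaving-injective (correct S∈) (subst (Interleaving k _ w) (sym eq) (correct S′∈))))
      (masks-unique (c k) (run w) _)
      where
      correct : ∀ {S} → S ∈ masks (c k) (run w) (length w ∸ run w) → Interleaving k S w (interleave k S w)
      correct {S} S∈ = interleave-correct S (letters w∈)
        (trans (IsMask.falses≡ (masks-sound (c k) (run w) _ S∈)) (m+[n∸m]≡n (run≤length w)))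
    extensions-disjoint : ∀ {w w′ u} → w ∈ words k → w′ ∈ words k → u ∈ extensions k w → u ∈ extensions k w′ → w ≡ w′
    extensions-disjoint w∈ w′∈ u∈ u∈′
      with _ , _ , I ← extensions⁻ (letters w∈) u∈ | _ , _ , J ← extensions⁻ (letters w′∈) u∈′ =
      proj₂ (interleaving-injective I J)

  words-length : ∀ k {u} → u ∈ words k → length u ≡ size k
  words-length zero    (here refl) = refl
  words-length (suc k) u∈
    with w , w∈ , u∈′ ← ∈-concatMap⁻′ (extensions k) {words k} u∈
    with S , mask , I ← extensions⁻ (AvoidingWord.letters (words-sound k w∈)) u∈′ =
    trans (length-interleaving I) (cong₂ _+_ (IsMask.trues≡ mask) (words-length k w∈))

  ∑-run : ∀ k (f : ℕ → ℕ) → ∑ (f ∘ run) (words (suc k)) ≡ ∑ (transfer (c k) f ∘ run) (words k)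
  ∑-run k f = trans (∑-concatMap (f ∘ run) (extensions k) (words k)) (∑-cong (words k) ∑-extensions)
    where
    ∑-extensions : ∀ {w} → w ∈ words k → ∑ (f ∘ run) (extensions k w) ≡ transfer (c k) f (run w)
    ∑-extensions {w} w∈ = begin
      ∑ (f ∘ run) (extensions k w)                 ≡⟨ ∑-map (f ∘ run) (λ S → interleave k S w) ms ⟩
      ∑ (λ S → f (run (interleave k S w))) ms      ≡⟨ ∑-cong ms (λ {S} S∈ → cong f (run-interleaving (interleave-correct S letters
                                                       (trans (IsMask.falses≡ (masks-sound (c k) (run w) _ S∈)) (m+[n∸m]≡n (run≤length w)))))) ⟩
      ∑ (f ∘ newRun (run w)) ms                    ≡⟨ ∑-newRun (c k) (run w) _ f ⟩
      transfer (c k) f (run w)                            ∎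
      where
      open ≡-Reasoning
      ms = masks (c k) (run w) (length w ∸ run w)
      letters = AvoidingWord.letters (words-sound k w∈)

  module _ (i p : ℕ) (cᵢ≡p : c i ≡ p) (c≡1 : ∀ a → a ≢ i → c a ≡ 1) where

    -- Each letter below i puts a `transfer₁` outside `transfer p`; commuted inward, it raises
    -- `ballot m` to `ballot (suc m)`. On the empty word the p copies alone form a run of p.
    ∑-before : ∀ j m → j ≤ i → ∑ (transfer p (ballot m) ∘ run) (words j) ≡ ballot (j + m) p
    ∑-before zero    m _   = trans (+-identityʳ _) (transfer-zeroʳ p (ballot m))
    ∑-before (suc j) m j<i = begin
      ∑ (transfer p (ballot m) ∘ run) (words (suc j))       ≡⟨ ∑-run j (transfer p (ballot m)) ⟩
      ∑ (transfer (c j) (transfer p (ballot m)) ∘ run) (words j)   ≡⟨ ∑-cong (words j) (λ {w} _ → step (run w)) ⟩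
      ∑ (transfer p (ballot (suc m)) ∘ run) (words j)       ≡⟨ ∑-before j (suc m) (<⇒≤ j<i) ⟩
      ballot (j + suc m) p                           ≡⟨ cong (λ x → ballot x p) (+-suc j m) ⟩
      ballot (suc j + m) p                           ∎
      where
      open ≡-Reasoning
      step : ∀ d → transfer (c j) (transfer p (ballot m)) d ≡ transfer p (ballot (suc m)) d
      step d rewrite c≡1 j (<⇒≢ j<i) = trans (transfer-one (transfer p (ballot m)) d) (transfer₁-transfer-comm p (ballot m) d)

    -- The operators of the letters above i act on `ballot m` directly; m stands for the number of
    -- single letters already peeled.
    ∑-after : ∀ j m → ∑ (ballot m ∘ run) (words (j + suc i)) ≡ ballot (j + (i + m)) p
    ∑-after zero    m = trans (∑-run i (ballot m))
      (trans (cong (λ q → ∑ (transfer q (ballot m) ∘ run) (words i)) cᵢ≡p) (∑-before i m ≤-refl))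
    ∑-after (suc j) m = begin
      ∑ (ballot m ∘ run) (words (suc (j + suc i)))               ≡⟨ ∑-run (j + suc i) (ballot m) ⟩
      ∑ (transfer (c (j + suc i)) (ballot m) ∘ run) (words (j + suc i)) ≡⟨ ∑-cong (words (j + suc i)) (λ {w} _ → step (run w)) ⟩
      ∑ (ballot (suc m) ∘ run) (words (j + suc i))               ≡⟨ ∑-after j (suc m) ⟩
      ballot (j + (i + suc m)) p                                 ≡⟨ cong (λ x → ballot x p) (trans (cong (j +_) (+-suc i m)) (+-suc j (i + m))) ⟩
      ballot (suc j + (i + m)) p                                 ∎
      where
      open ≡-Reasoning
      step : ∀ d → transfer (c (j + suc i)) (ballot m) d ≡ ballot (suc m) d
      step d rewrite c≡1 (j + suc i) (>⇒≢ (m≤n+m (suc i) j)) = transfer-one (ballot m) d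

    size-before : ∀ j → j ≤ i → size j ≡ j
    size-before zero    _   = refl
    size-before (suc j) j<i = cong₂ _+_ (c≡1 j (<⇒≢ j<i)) (size-before j (<⇒≤ j<i))

    size-after : ∀ j → size (j + suc i) ≡ p + (j + i)
    size-after zero    = cong₂ _+_ cᵢ≡p (size-before i ≤-refl)
    size-after (suc j) = trans (cong₂ _+_ (c≡1 (j + suc i) (>⇒≢ (m≤n+m (suc i) j))) (size-after j)) (sym (+-suc p (j + i)))

    words-count : ∀ j → length (words (j + suc i)) ≡ ballot (j + i) p
    words-count j = begin
      length (words (j + suc i))          ≡⟨ *-identityˡ _ ⟨
      1 * length (words (j + suc i))      ≡⟨ ∑-const 1 (words (j + suc i)) ⟨
      ∑ (ballot 0 ∘ run) (words (j + suc i))   ≡⟨ ∑-after j 0 ⟩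
      ballot (j + (i + 0)) p                   ≡⟨ cong (λ x → ballot (j + x) p) (+-identityʳ i) ⟩
      ballot (j + i) p                         ∎
      where open ≡-Reasoning

-- Ordered partitions as words of block indices

-- Total, with value 0 past the end; where this default would matter, a bound on the position or the
-- length is assumed.
at : List ℕ → ℕ → ℕ
at []      _       = 0
at (a ∷ w) zero    = a
at (a ∷ w) (suc i) = at w i

at-extensional : ∀ {w w′} → length w ≡ length w′ → (∀ i → i < length w → at w i ≡ at w′ i) → w ≡ w′
at-extensional {[]}    {[]}     _  _  = refl
at-extensional {a ∷ w} {b ∷ w′} len eq =
  cong₂ _∷_ (eq 0 z<s) (at-extensional (suc-injective len) λ i i< → eq (suc i) (s<s i<))

at-tabulate : ∀ {n} (f : Fin n → ℕ) x → at (tabulate f) (toℕ x) ≡ f x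
at-tabulate f zero    = refl
at-tabulate f (suc x) = at-tabulate (f ∘ suc) x

All-at⁻ : ∀ {P : ℕ → Set} {w} → All P w → ∀ i → i < length w → P (at w i)
All-at⁻ (p ∷ _)   zero    _        = p
All-at⁻ (_ ∷ all) (suc i) (s≤s i<) = All-at⁻ all i i<

All-at⁺ : ∀ {P : ℕ → Set} w → (∀ i → i < length w → P (at w i)) → All P w
All-at⁺ []      _ = []
All-at⁺ (a ∷ w) p = p 0 z<s ∷ All-at⁺ w λ i i< → p (suc i) (s<s i<)

occ-position : ∀ {a} w → 0 < occ a w → ∃ λ i → i < length w × at w i ≡ a
occ-position {a} (x ∷ w) 0< with x ≟ a
... | yes refl = 0 , z<s , refl
... | no  x≢a  with i , i< , eq ← occ-position w (subst (0 <_) (occ-≢ w x≢a) 0<) = suc i , s<s i< , eq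

avoids23⇒at : ∀ {a w} → Avoids23 a w →
  ∀ y z → y < z → z < length w → a < at w y → ¬ at w y < at w z
avoids23⇒at {w = b ∷ w} (above , _) zero    (suc z) _         (s≤s z<) a<b b<c = <⇒≱ b<c (All-at⁻ (above a<b) z z<)
avoids23⇒at {w = b ∷ w} (_ , av)    (suc y) (suc z) (s≤s y<z) (s≤s z<) a<b b<c = avoids23⇒at av y z y<z z< a<b b<c

avoids⇒at : ∀ {w} → Avoids w →
  ∀ x y z → x < y → y < z → z < length w → at w x < at w y → ¬ at w y < at w z
avoids⇒at {a ∷ w} (av , _) zero    (suc y) (suc z) _         (s≤s y<z) (s≤s z<) = avoids23⇒at av y z y<z z<
avoids⇒at {a ∷ w} (_ , av) (suc x) (suc y) (suc z) (s≤s x<y) (s≤s y<z) (s≤s z<) = avoids⇒at av x y z x<y y<z z<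

at⇒avoids23 : ∀ {a} w →
  (∀ y z → y < z → z < length w → a < at w y → ¬ at w y < at w z) → Avoids23 a w
at⇒avoids23 []      _  = _
at⇒avoids23 (b ∷ w) h =
  (λ a<b → All-at⁺ w λ z z< → ≮⇒≥ (h 0 (suc z) z<s (s<s z<) a<b)) ,
  at⇒avoids23 w λ y z y<z z< → h (suc y) (suc z) (s<s y<z) (s<s z<)

at⇒avoids : ∀ w →
  (∀ x y z → x < y → y < z → z < length w → at w x < at w y → ¬ at w y < at w z) → Avoids w
at⇒avoids []      _  = _
at⇒avoids (a ∷ w) h =
  at⇒avoids23 w (λ y z y<z z< → h 0 (suc y) (suc z) z<s (s<s y<z) (s<s z<)) ,
  at⇒avoids w λ x y z x<y y<z z< → h (suc x) (suc y) (suc z) (s<s x<y) (s<s y<z) (s<s z<)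

positions : (n a : ℕ) → List ℕ → Subset n
positions n a w = Vec.tabulate λ x → does (at w (toℕ x) ≟ a)

∣positions∣ : ∀ {n} a w → length w ≡ n → ∣ positions n a w ∣ ≡ occ a w
∣positions∣ a []      refl = refl
∣positions∣ a (x ∷ w) refl with does (x ≟ a)
... | true  = cong suc (∣positions∣ a w refl)
... | false = ∣positions∣ a w refl

blocks : (n k : ℕ) → List ℕ → Vec (Subset n) k
blocks n k w = Vec.tabulate λ j → positions n (toℕ j) w

module _ {n k : ℕ} where

  lookup-blocks : ∀ w (j : Fin k) → lookup (blocks n k w) j ≡ positions n (toℕ j) w
  lookup-blocks w j = lookup∘tabulate (λ j → positions n (toℕ j) w) j

  ∈-blocks⁺ : ∀ w {j : Fin k} {x : Fin n} → at w (toℕ x) ≡ toℕ j → x ∈ₛ lookup (blocks n k w) j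
  ∈-blocks⁺ w {j} {x} eq = subst (x ∈ₛ_) (sym (lookup-blocks w j))
    (lookup⇒[]= x _ (trans (lookup∘tabulate _ x) (dec-true (at w (toℕ x) ≟ toℕ j) eq)))

  ∈-blocks⁻ : ∀ w {j : Fin k} {x : Fin n} → x ∈ₛ lookup (blocks n k w) j → at w (toℕ x) ≡ toℕ j
  ∈-blocks⁻ w {j} {x} x∈ with at w (toℕ x) ≟ toℕ j in eq
  ... | yes p = p
  ... | no  _ = contradiction (trans (sym (cong does eq)) (trans (sym (lookup∘tabulate _ x))
                  ([]=⇒lookup (subst (x ∈ₛ_) (lookup-blocks w j) x∈)))) λ ()

  ∣block∣ : ∀ w (j : Fin k) → length w ≡ n → ∣ lookup (blocks n k w) j ∣ ≡ occ (toℕ j) w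
  ∣block∣ w j len = trans (cong ∣_∣ (lookup-blocks w j)) (∣positions∣ (toℕ j) w len)

  -- The bound on the letters lets the letter of `w` at a position name an actual block; equality of
  -- the blocks puts that position into the same block for `w′`.
  blocks-injective : ∀ {w w′} → length w ≡ n → length w′ ≡ n → All (_< k) w →
    blocks n k w ≡ blocks n k w′ → w ≡ w′
  blocks-injective {w} {w′} len len′ letters eq = at-extensional (trans len (sym len′)) λ i i< →
    let x  = fromℕ< (subst (i <_) len i<)
        j  = fromℕ< (All-at⁻ letters i i<)
        tx = toℕ-fromℕ< (subst (i <_) len i<)
        tj = toℕ-fromℕ< (All-at⁻ letters i i<)
        x∈ = ∈-blocks⁺ w {j} {x} (trans (cong (at w) tx) (sym tj))
    in sym (trans (cong (at w′) (sym tx)) (trans (∈-blocks⁻ w′ (subst (λ B → x ∈ₛ lookup B j) eq x∈)) tj))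

  blocks-isOrderedPartition : ∀ {w} → length w ≡ n → All (_< k) w → (∀ a → a < k → 0 < occ a w) →
    IsOrderedPartition (blocks n k w)
  blocks-isOrderedPartition {w} len letters occurs = record
    { nonempty = λ j → let i , i< , eq = occ-position w (occurs (toℕ j) (toℕ<n j))
                           i<n = subst (i <_) len i<
                       in fromℕ< i<n , ∈-blocks⁺ w (trans (cong (at w) (toℕ-fromℕ< i<n)) eq)
    ; disjoint = λ i j i≢j (x , x∈) → let x∈i , x∈j = x∈p∩q⁻ _ _ x∈
                 in i≢j (toℕ-injective (trans (sym (∈-blocks⁻ w x∈i)) (∈-blocks⁻ w x∈j)))
    ; covers   = λ x → let a< = All-at⁻ letters (toℕ x) (subst (toℕ x <_) (sym len) (toℕ<n x))
                       in fromℕ< a< , ∈-blocks⁺ w (sym (toℕ-fromℕ< a<))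
    }

  blocks-avoids : ∀ {w} → length w ≡ n → Avoids w → Avoids123 (blocks n k w)
  blocks-avoids {w} len av record { b₁ = b₁ ; b₂ = b₂ ; b₃ = b₃ ; i₁<i₂ = i₁<i₂ ; i₂<i₃ = i₂<i₃ ; b₁∈ = b₁∈ ; b₂∈ = b₂∈ ; b₃∈ = b₃∈ ; b₁<b₂ = b₁<b₂ ; b₂<b₃ = b₂<b₃ } =
    avoids⇒at av (toℕ b₁) (toℕ b₂) (toℕ b₃) b₁<b₂ b₂<b₃ (subst (toℕ b₃ <_) (sym len) (toℕ<n b₃))
      (subst₂ _<_ (sym (∈-blocks⁻ w b₁∈)) (sym (∈-blocks⁻ w b₂∈)) i₁<i₂)
      (subst₂ _<_ (sym (∈-blocks⁻ w b₂∈)) (sym (∈-blocks⁻ w b₃∈)) i₂<i₃)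

  avoids-blocks : ∀ {w} → length w ≡ n → All (_< k) w → Avoids123 (blocks n k w) → Avoids w
  avoids-blocks {w} len letters av = at⇒avoids w λ x y z x<y y<z z< a<b b<c →
    let y< = <-trans y<z z<
        x< = <-trans x<y y<
        fin  = λ {i} (i< : i < length w) → fromℕ< (subst (i <_) len i<)
        toℕ-fin = λ {i} (i< : i < length w) → toℕ-fromℕ< (subst (i <_) len i<)
        letter = λ {i} (i< : i < length w) → fromℕ< (All-at⁻ letters i i<)
        toℕ-letter = λ {i} (i< : i < length w) → toℕ-fromℕ< (All-at⁻ letters i i<)
        mem  = λ {i} (i< : i < length w) → ∈-blocks⁺ w {letter i<} {fin i<} (trans (cong (at w) (toℕ-fin i<)) (sym (toℕ-letter i<)))
    in av record
      { b₁∈ = mem x< ; b₂∈ = mem y< ; b₃∈ = mem z<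
      ; i₁<i₂ = subst₂ _<_ (sym (toℕ-letter x<)) (sym (toℕ-letter y<)) a<b
      ; i₂<i₃ = subst₂ _<_ (sym (toℕ-letter y<)) (sym (toℕ-letter z<)) b<c
      ; b₁<b₂ = subst₂ _<_ (sym (toℕ-fin x<)) (sym (toℕ-fin y<)) x<y
      ; b₂<b₃ = subst₂ _<_ (sym (toℕ-fin y<)) (sym (toℕ-fin z<)) y<z
      }

  module _ {B : Vec (Subset n) k} (partition : IsOrderedPartition B) where
    open IsOrderedPartition partition

    blockWord : List ℕ
    blockWord = tabulate (toℕ ∘ proj₁ ∘ covers)

    blockWord-length : length blockWord ≡ n
    blockWord-length = length-tabulate (toℕ ∘ proj₁ ∘ covers)

    blockWord-letters : All (_< k) blockWord
    blockWord-letters = All-at⁺ blockWord λ i i< →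
      let i<n = subst (i <_) blockWord-length i<
          x   = fromℕ< i<n
      in subst (_< k) (trans (sym (at-tabulate (toℕ ∘ proj₁ ∘ covers) x)) (cong (at blockWord) (toℕ-fromℕ< i<n))) (toℕ<n (proj₁ (covers x)))

    -- The index that `covers` chooses for an element is the only possible one, by disjointness.
    blocks-blockWord : blocks n k blockWord ≡ B
    blocks-blockWord = trans (sym (tabulate∘lookup _)) (trans (tabulate-cong same) (tabulate∘lookup B))
      where
      same : ∀ j → lookup (blocks n k blockWord) j ≡ lookup B j
      same j = ⊆-antisym
        (λ {x} x∈ → subst (λ i → x ∈ₛ lookup B i)
          (toℕ-injective (trans (sym (at-tabulate (toℕ ∘ proj₁ ∘ covers) x)) (∈-blocks⁻ blockWord x∈))) (proj₂ (covers x)))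
        (λ {x} x∈ → ∈-blocks⁺ blockWord (trans (at-tabulate (toℕ ∘ proj₁ ∘ covers) x) (cong toℕ (index-unique x∈ (proj₂ (covers x))))))
        where
        index-unique : ∀ {i j x} → x ∈ₛ lookup B j → x ∈ₛ lookup B i → i ≡ j
        index-unique {i} {j} x∈j x∈i with i Fin.≟ j
        ... | yes i≡j = i≡j
        ... | no  i≢j = contradiction (_ , x∈p∩q⁺ (x∈i , x∈j)) (disjoint i j i≢j)

-- Counting marked partitions

content : ℕ → ℕ → ℕ → ℕ
content p i a = if does (a ≟ i) then p else 1

content-≡ : ∀ p i → content p i i ≡ p
content-≡ p i rewrite dec-true (i ≟ i) refl = refl

content-≢ : ∀ p i a → a ≢ i → content p i a ≡ 1
content-≢ p i a a≢i rewrite dec-false (a ≟ i) a≢i = refl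

content-positive : ∀ {p} → 1 ≤ p → ∀ i a → 0 < content p i a
content-positive 1≤p i a with does (a ≟ i)
... | true  = 1≤p
... | false = z<s

module _ (n p m : ℕ) (1≤p : 1 ≤ p) (n≡p+m : n ≡ p + m) where

  private
    k = suc m

  markedWords : Fin k → List (List ℕ)
  markedWords i = words (content p (toℕ i)) k

  -- The number of letters above i, which brings k into the form `j + suc (toℕ i)` of `words-count`
  -- and `size-after`.
  remaining : ∀ (i : Fin k) → ∃ λ j → j + toℕ i ≡ m
  remaining i = m ∸ toℕ i , m∸n+n≡m (≤-pred (toℕ<n i))

  markedWords-length : ∀ i {w} → w ∈ markedWords i → length w ≡ n
  markedWords-length i {w} w∈ with j , j+i≡m ← remaining i = begin
    length w                                    ≡⟨ words-length (content p (toℕ i)) k w∈ ⟩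
    size (content p (toℕ i)) k                  ≡⟨ cong (size (content p (toℕ i))) (trans (+-suc j (toℕ i)) (cong suc j+i≡m)) ⟨
    size (content p (toℕ i)) (j + suc (toℕ i))  ≡⟨ size-after _ (toℕ i) p (content-≡ p (toℕ i)) (content-≢ p (toℕ i)) j ⟩
    p + (j + toℕ i)                             ≡⟨ cong (p +_) j+i≡m ⟩
    p + m                                       ≡⟨ n≡p+m ⟨
    n                                           ∎
    where open ≡-Reasoning

  markedWords-count : ∀ i → length (markedWords i) ≡ ballot m p
  markedWords-count i with j , j+i≡m ← remaining i = begin
    length (words (content p (toℕ i)) k)                 ≡⟨ cong (length ∘ words (content p (toℕ i))) (trans (+-suc j (toℕ i)) (cong suc j+i≡m)) ⟨
    length (words (content p (toℕ i)) (j + suc (toℕ i))) ≡⟨ words-count _ (toℕ i) p (content-≡ p (toℕ i)) (content-≢ p (toℕ i)) j ⟩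
    ballot (j + toℕ i) p                                      ≡⟨ cong (λ x → ballot x p) j+i≡m ⟩
    ballot m p                                                ∎
    where open ≡-Reasoning

  marked : Fin k → List (Vec (Subset n) k × Fin k)
  marked i = map (λ w → blocks n k w , i) (markedWords i)

  marked-sound : ∀ {B i} → (B , i) ∈ marked i → MarkedAvoidingPartition p (B , i)
  marked-sound {i = i} Bi∈ with w , w∈ , refl ← ∈-map⁻ (λ w → blocks n k w , i) Bi∈
    with avoidingWord letters occ≡ avoids ← words-sound (content p (toℕ i)) k w∈ =
    blocks-isOrderedPartition len letters (λ a a<k → subst (0 <_) (sym (occ≡ a a<k)) (content-positive 1≤p (toℕ i) a)) ,
    blocks-avoids len avoids ,
    trans (block-size i) (content-≡ p (toℕ i)) ,
    λ j j≢i → trans (block-size j) (content-≢ p (toℕ i) (toℕ j) (j≢i ∘ toℕ-injective))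
    where
    len = markedWords-length i w∈
    block-size : ∀ j → ∣ lookup (blocks n k w) j ∣ ≡ content p (toℕ i) (toℕ j)
    block-size j = trans (∣block∣ w j len) (occ≡ (toℕ j) (toℕ<n j))

  marked-complete : ∀ {B i} → MarkedAvoidingPartition p (B , i) → (B , i) ∈ marked i
  marked-complete {B} {i} (partition , avoids , sizeᵢ , size₁) =
    subst (λ B → (B , i) ∈ marked i) (blocks-blockWord partition)
      (∈-map⁺ (λ w → blocks n k w , i) (words-complete (content p (toℕ i)) k
        (avoidingWord letters occ≡ (avoids-blocks len letters (subst Avoids123 (sym (blocks-blockWord partition)) avoids)))))
    where
    w       = blockWord partition
    len     = blockWord-length partition
    letters = blockWord-letters partition
    block-size : ∀ j → ∣ lookup B j ∣ ≡ content p (toℕ i) (toℕ j)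
    block-size j with j Fin.≟ i
    ... | yes refl = trans sizeᵢ (sym (content-≡ p (toℕ i)))
    ... | no  j≢i  = trans (size₁ j j≢i) (sym (content-≢ p (toℕ i) (toℕ j) (j≢i ∘ toℕ-injective)))
    occ≡ : ∀ a → a < k → occ a w ≡ content p (toℕ i) a
    occ≡ a a<k = subst (λ a → occ a w ≡ content p (toℕ i) a) (toℕ-fromℕ< a<k) (begin
      occ (toℕ j) w                 ≡⟨ ∣block∣ w j len ⟨
      ∣ lookup (blocks n k w) j ∣   ≡⟨ cong (λ B → ∣ lookup B j ∣) (blocks-blockWord partition) ⟩
      ∣ lookup B j ∣                ≡⟨ block-size j ⟩
      content p (toℕ i) (toℕ j)     ∎)
      where
      open ≡-Reasoning
      j = fromℕ< a<k

  marked-index : ∀ {i x} → x ∈ marked i → proj₂ x ≡ i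
  marked-index {i} x∈ with _ , _ , refl ← ∈-map⁻ (λ w → blocks n k w , i) x∈ = refl

  marked-unique : ∀ i → Unique (marked i)
  marked-unique i = Unique-map (λ w → blocks n k w , i)
    (λ w∈ w′∈ eq → blocks-injective (markedWords-length i w∈) (markedWords-length i w′∈)
      (AvoidingWord.letters (words-sound (content p (toℕ i)) k w∈)) (cong proj₁ eq))
    (words-unique (content p (toℕ i)) k)

  marked-cardinality : HasCardinality {Vec (Subset n) k × Fin k} (MarkedAvoidingPartition p) (k * ballot m p)
  marked-cardinality = concatMap marked (allFin k) ,
    Unique-concatMap marked (λ {i} _ → marked-unique i)
      (λ {i} {i′} _ _ x∈i x∈i′ → trans (sym (marked-index x∈i)) (marked-index x∈i′)) (Unique.allFin⁺ k) ,
    (λ (B , i) → mk⇔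
      (λ Bi∈ → let i′ , _ , Bi∈′ = ∈-concatMap⁻′ marked {allFin k} Bi∈ in
        marked-sound (subst (λ j → (B , i) ∈ marked j) (sym (marked-index Bi∈′)) Bi∈′))
      (λ P → ∈-concatMap⁺′ marked (∈-allFin i) (marked-complete P))) ,
    (begin
      length (concatMap marked (allFin k))       ≡⟨ length≡∑ (concatMap marked (allFin k)) ⟩
      ∑ (const 1) (concatMap marked (allFin k))  ≡⟨ ∑-concatMap (const 1) marked (allFin k) ⟩
      ∑ (∑ (const 1) ∘ marked) (allFin k)        ≡⟨ ∑-cong (allFin k) (λ {i} _ → trans (sym (length≡∑ (marked i)))
                                                      (trans (length-map _ (markedWords i)) (markedWords-count i))) ⟩
      ∑ (const (ballot m p)) (allFin k)               ≡⟨ ∑-const (ballot m p) (allFin k) ⟩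
      ballot m p * length (allFin k)                  ≡⟨ cong (ballot m p *_) (length-tabulate {n = k} (λ i → i)) ⟩
      ballot m p * k                                  ≡⟨ *-comm (ballot m p) k ⟩
      k * ballot m p                                  ∎)
    where
    open ≡-Reasoning
    length≡∑ : ∀ {X : Set} (xs : List X) → length xs ≡ ∑ (const 1) xs
    length≡∑ xs = sym (trans (∑-const 1 xs) (*-identityˡ (length xs)))

-- Forgetting the mark is injective: with two different marks, the block at the first would have
-- size p by one and size 1 by the other.
unmark-cardinality : ∀ {n k p N} → 2 ≤ p →
  HasCardinality {Vec (Subset n) k × Fin k} (MarkedAvoidingPartition p) N →
  HasCardinality {Vec (Subset n) k} (AvoidingPartition p) N
unmark-cardinality {p = p} 2≤p (xs , unique , spec , count) =
  map proj₁ xs ,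
  Unique-map proj₁ (λ {x} {y} x∈ y∈ → same-mark (Equivalence.to (spec x) x∈) (Equivalence.to (spec y) y∈)) unique ,
  (λ B → mk⇔
    (λ B∈ → let (B′ , i) , x∈ , eq = ∈-map⁻ proj₁ B∈
                partition , avoids , sizes = Equivalence.to (spec (B′ , i)) x∈
            in subst (AvoidingPartition p) (sym eq) (partition , avoids , i , sizes))
    (λ (partition , avoids , i , sizes) → ∈-map⁺ proj₁ (Equivalence.from (spec (B , i)) (partition , avoids , sizes)))) ,
  trans (length-map proj₁ xs) count
  where
  same-mark : ∀ {x y} → MarkedAvoidingPartition p x → MarkedAvoidingPartition p y → proj₁ x ≡ proj₁ y → x ≡ y
  same-mark {B , i} {_ , j} (_ , _ , sizeᵢ , _) (_ , _ , _ , size₁) refl with i Fin.≟ j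
  ... | yes refl = refl
  ... | no  i≢j  = contradiction (trans (sym sizeᵢ) (size₁ i i≢j)) (>⇒≢ 2≤p)

theorem6 : (n p : ℕ) → 1 ≤ p → p < n →
    ∃ λ (N : ℕ) →
    HasCardinality {Vec (Subset n) (n ∸ p + 1) × Fin (n ∸ p + 1)} (MarkedAvoidingPartition p) N
    × (2 ≤ p → HasCardinality {Vec (Subset n) (n ∸ p + 1)} (AvoidingPartition p) N)
    × N * (n + 1) ≡ (n ∸ p + 1) * (p + 1) * ((2 * n ∸ p) C (n ∸ p))
theorem6 n p 1≤p p<n = (m + 1) * ballot m p , cardinality , (λ 2≤p → unmark-cardinality 2≤p cardinality) , (begin
  (m + 1) * ballot m p * (n + 1)                  ≡⟨ *-assoc (m + 1) (ballot m p) (n + 1) ⟩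
  (m + 1) * (ballot m p * (n + 1))                ≡⟨ cong (λ x → (m + 1) * (ballot m p * x)) (trans (+-comm n 1) (cong suc (sym m+p≡n))) ⟩
  (m + 1) * (ballot m p * suc (m + p))            ≡⟨ cong ((m + 1) *_) (ballot-formula m p) ⟩
  (m + 1) * (suc p * ((2 * m + p) C m))      ≡⟨ cong₂ (λ x y → (m + 1) * (x * (y C m))) (+-comm 1 p) 2m+p≡2n∸p ⟩
  (m + 1) * ((p + 1) * ((2 * n ∸ p) C m))    ≡⟨ *-assoc (m + 1) (p + 1) _ ⟨
  (m + 1) * (p + 1) * ((2 * n ∸ p) C m)      ∎)
  where
  open ≡-Reasoning
  m = n ∸ p
  m+p≡n : m + p ≡ n
  m+p≡n = m∸n+n≡m (<⇒≤ p<n)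
  cardinality : HasCardinality {Vec (Subset n) (m + 1) × Fin (m + 1)} (MarkedAvoidingPartition p) ((m + 1) * ballot m p)
  -- Passes from the `suc m` blocks of the construction to the `m + 1` of the statement.
  cardinality = subst (λ k → HasCardinality {Vec (Subset n) k × Fin k} (MarkedAvoidingPartition p) (k * ballot m p)) (+-comm 1 m)
    (marked-cardinality n p m 1≤p (trans (sym m+p≡n) (+-comm m p)))
  regroup : ∀ m p → 2 * (m + p) ≡ (2 * m + p) + p
  regroup = solve-∀
  2m+p≡2n∸p : 2 * m + p ≡ 2 * n ∸ p
  2m+p≡2n∸p = begin
    2 * m + p           ≡⟨ m+n∸n≡m (2 * m + p) p ⟨
    2 * m + p + p ∸ p   ≡⟨ cong (_∸ p) (trans (sym (regroup m p)) (cong (2 *_) m+p≡n)) ⟩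
    2 * n ∸ p           ∎
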